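{- For all $n\ge k\ge1$, $$\mathbf{Sf}_{n,k}(p,q)\big|_{p^0}=q^{n-k}\begin{bmatrix} n-1\\ k-1\end{bmatrix}_q,$$ and for all $n>k\ge3$, $$\mathbf{Sf}_{n,k}(p,q)\big|_{p}=q^{n-k}\sum_{s=1}^{k-2}s\,q^{s-1}\sum_{i=0}^{n-k-1}q^{i(s+1)}\begin{bmatrix} i+k-s-2\\ i\end{bmatrix}_q\begin{bmatrix} s+n-k-i\\ s+1\end{bmatrix}_q.$$
   Context: $F_1(p,q)=q$, $F_2(p,q)=q^2$ and $F_m(p,q)=qF_{m-1}(p,q)+pF_{m-2}(p,q)$ for $m\ge3$. Let $(x)_{\downarrow_{F,p,q,0}}=1$ and $(x)_{\downarrow_{F,p,q,k}}=x(x-F_1(p,q))\cdots(x-F_{k-1}(p,q))$ for $k\ge1$. Define $\mathbf{Sf}_{n,k}(p,q)$ for $0\le k\le n$ by $x^n=\sum_{k=0}^n\mathbf{Sf}_{n,k}(p,q)(x)_{\downarrow_{F,p,q,k}}$; it is a polynomial in $p,q$. For a polynomial $f$ in $p$ (with coefficients polynomials in $q$), $f|_{p^s}$ denotes the coefficient of $p^s$. $[m]_q=1+q+\cdots+q^{m-1}$, $[m]_q!=[m]_q[m-1]_q\cdots[1]_q$ with $[0]_q!=1$, and $\begin{bmatrix} n\\ k\end{bmatrix}_q=\frac{[n]_q!}{[k]_q![n-k]_q!}$. -}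

module Defs where

open import Level using (_⊔_; 0ℓ)
open import Algebra.Bundles using (CommutativeRing)
open import Data.Fin.Base using (Fin; toℕ; inject₁; fromℕ)
import Data.Fin.Properties as Fin
import Data.Integer.Properties as ℤ
open import Data.List.Base using (List; []; _∷_; map)
open import Data.Nat.Base as ℕ using (ℕ; zero; suc; _∸_; _≤_)
import Data.Nat.Properties as ℕ
open import Data.Product.Base using (∃; _,_)
import Relation.Binary.PropositionalEquality as ≡
import Relation.Binary.Reasoning.Setoid as SetoidReasoning
import Algebra.Solver.Ring.NaturalCoefficients.Default as NatSolver

module Ring {c ℓ} (R : CommutativeRing c ℓ) where
  open CommutativeRing R public hiding (zero)
  open import Algebra.Properties.Semiring.Sum semiring public
    using (sum; sum-syntax; sum⁺-syntax; sum-cong-≋; sum-init-last;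
           ∑-distrib-+; *-distribˡ-sum; *-distribʳ-sum)
  open import Algebra.Properties.Semiring.Exp semiring public
    using (_^_)
  open import Algebra.Properties.Semiring.Mult semiring public
    using (_×_)

-- Univariate polynomials over R: lists of coefficients, constant term first.
-- Trailing zeros are allowed, so equality compares coefficients.

module Polynomial {c ℓ} (R : CommutativeRing c ℓ) where
  open CommutativeRing R hiding (zero)
  open SetoidReasoning setoid

  Poly : Set c
  Poly = List Carrier

  coeff : Poly → ℕ → Carrier
  coeff []      _       = 0#
  coeff (a ∷ f) zero    = a
  coeff (a ∷ f) (suc i) = coeff f i

  infix 4 _≈ₚ_
  record _≈ₚ_ (f g : Poly) : Set ℓ where
    constructor coeffwise
    field coeff-≈ : ∀ i → coeff f i ≈ coeff g i
  open _≈ₚ_ public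

  const : Carrier → Poly
  const a = a ∷ []

  indeterminate : Poly
  indeterminate = 0# ∷ 1# ∷ []

  infixl 6 _+ₚ_
  infixl 7 _*ₚ_

  _+ₚ_ : Poly → Poly → Poly
  []      +ₚ g       = g
  (a ∷ f) +ₚ []      = a ∷ f
  (a ∷ f) +ₚ (b ∷ g) = (a + b) ∷ (f +ₚ g)

  -ₚ_ : Poly → Poly
  -ₚ_ = map (-_)

  _*ₚ_ : Poly → Poly → Poly
  []      *ₚ g = []
  (a ∷ f) *ₚ g = map (a *_) g +ₚ (0# ∷ f *ₚ g)

  private
    module Solver = NatSolver commutativeSemiring
    open Solver using (solve; _:=_; _:+_; _:*_)

    Seq : Set c
    Seq = ℕ → Carrier

    conv : Seq → Seq → Seq
    conv u v zero    = u 0 * v 0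
    conv u v (suc i) = u 0 * v (suc i) + conv (λ j → u (suc j)) v i

    conv-cong : ∀ {u u′ v v′} → (∀ i → u i ≈ u′ i) → (∀ i → v i ≈ v′ i) →
                ∀ i → conv u v i ≈ conv u′ v′ i
    conv-cong e e′ zero    = *-cong (e 0) (e′ 0)
    conv-cong e e′ (suc i) = +-cong (*-cong (e 0) (e′ (suc i)))
                                    (conv-cong (λ j → e (suc j)) e′ i)

    conv-zeroˡ : ∀ v i → conv (λ _ → 0#) v i ≈ 0#
    conv-zeroˡ v zero    = zeroˡ _
    conv-zeroˡ v (suc i) = trans (+-cong (zeroˡ _) (conv-zeroˡ v i)) (+-identityˡ _)

    conv-linearˡ : ∀ a u u′ v i →
      conv (λ j → a * u j + u′ j) v i ≈ a * conv u v i + conv u′ v i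
    conv-linearˡ a u u′ v zero =
      solve 4 (λ a x y z → (a :* x :+ y) :* z := a :* (x :* z) :+ y :* z)
        refl a (u 0) (u′ 0) (v 0)
    conv-linearˡ a u u′ v (suc i) =
      trans (+-congˡ (conv-linearˡ a (λ j → u (suc j)) (λ j → u′ (suc j)) v i))
        (solve 6 (λ a x y z c d → (a :* x :+ y) :* z :+ (a :* c :+ d)
                              := a :* (x :* z :+ c) :+ (y :* z :+ d))
          refl a (u 0) (u′ 0) (v (suc i)) _ _)

    conv-sucʳ : ∀ u v i →
      conv u v (suc i) ≈ u (suc i) * v 0 + conv u (λ j → v (suc j)) i
    conv-sucʳ u v zero    = +-comm _ _
    conv-sucʳ u v (suc i) =
      trans (+-congˡ (conv-sucʳ (λ j → u (suc j)) v i))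
        (solve 3 (λ x y z → x :+ (y :+ z) := y :+ (x :+ z)) refl _ _ _)

    conv-comm : ∀ u v i → conv u v i ≈ conv v u i
    conv-comm u v zero    = *-comm _ _
    conv-comm u v (suc i) =
      trans (+-cong (*-comm _ _) (conv-comm (λ j → u (suc j)) v i))
        (sym (conv-sucʳ v u i))

    conv-assoc : ∀ u v w i → conv (conv u v) w i ≈ conv u (conv v w) i
    conv-assoc u v w zero    = *-assoc _ _ _
    conv-assoc u v w (suc i) = begin
      (u 0 * v 0) * w (suc i) + conv (λ j → u 0 * v (suc j) + conv u⁺ v j) w i
        ≈⟨ +-congˡ (conv-linearˡ (u 0) (λ j → v (suc j)) (conv u⁺ v) w i) ⟩
      (u 0 * v 0) * w (suc i) +
        (u 0 * conv (λ j → v (suc j)) w i + conv (conv u⁺ v) w i)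
        ≈⟨ +-congˡ (+-congˡ (conv-assoc u⁺ v w i)) ⟩
      (u 0 * v 0) * w (suc i) +
        (u 0 * conv (λ j → v (suc j)) w i + conv u⁺ (conv v w) i)
        ≈⟨ solve 5 (λ x y z c d → (x :* y) :* z :+ (x :* c :+ d)
                               := x :* (y :* z :+ c) :+ d) refl _ _ _ _ _ ⟩
      u 0 * (v 0 * w (suc i) + conv (λ j → v (suc j)) w i) + conv u⁺ (conv v w) i ∎
      where
      u⁺ : Seq
      u⁺ j = u (suc j)

    conv-identityˡ : ∀ v i → conv (coeff (const 1#)) v i ≈ v i
    conv-identityˡ v zero    = *-identityˡ _
    conv-identityˡ v (suc i) =
      trans (+-cong (*-identityˡ _) (conv-zeroˡ v i)) (+-identityʳ _)

  coeff-+ : ∀ f g i → coeff (f +ₚ g) i ≈ coeff f i + coeff g i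
  coeff-+ []      g       i       = sym (+-identityˡ _)
  coeff-+ (a ∷ f) []      i       = sym (+-identityʳ _)
  coeff-+ (a ∷ f) (b ∷ g) zero    = refl
  coeff-+ (a ∷ f) (b ∷ g) (suc i) = coeff-+ f g i

  coeff-neg : ∀ f i → coeff (-ₚ f) i ≈ - coeff f i
  coeff-neg []      i       = begin
    0#        ≈⟨ -‿inverseʳ 0# ⟨
    0# - 0#   ≈⟨ +-identityˡ _ ⟩
    - 0#      ∎
  coeff-neg (a ∷ f) zero    = refl
  coeff-neg (a ∷ f) (suc i) = coeff-neg f i

  private
    coeff-scale : ∀ a f i → coeff (map (a *_) f) i ≈ a * coeff f i
    coeff-scale a []      i       = sym (zeroʳ a)
    coeff-scale a (b ∷ f) zero    = refl
    coeff-scale a (b ∷ f) (suc i) = coeff-scale a f i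

    coeff-* : ∀ f g i → coeff (f *ₚ g) i ≈ conv (coeff f) (coeff g) i
    coeff-* []      g i       = sym (conv-zeroˡ (coeff g) i)
    coeff-* (a ∷ f) g zero    =
      trans (coeff-+ (map (a *_) g) _ zero)
        (trans (+-identityʳ _) (coeff-scale a g zero))
    coeff-* (a ∷ f) g (suc i) =
      trans (coeff-+ (map (a *_) g) _ (suc i))
        (+-cong (coeff-scale a g (suc i)) (coeff-* f g i))

  polynomialRing : CommutativeRing c ℓ
  polynomialRing = record
    { Carrier = Poly
    ; _≈_ = _≈ₚ_
    ; _+_ = _+ₚ_
    ; _*_ = _*ₚ_
    ; -_  = -ₚ_
    ; 0#  = []
    ; 1#  = const 1#
    ; isCommutativeRing = record
      { isRing = record
        { +-isAbelianGroup = record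
          { isGroup = record
            { isMonoid = record
              { isSemigroup = record
                { isMagma = record
                  { isEquivalence = record
                    { refl  = coeffwise λ i → refl
                    ; sym   = λ e → coeffwise λ i → sym (coeff-≈ e i)
                    ; trans = λ e e′ → coeffwise λ i → trans (coeff-≈ e i) (coeff-≈ e′ i)
                    }
                  ; ∙-cong = λ {f} {f′} {g} {g′} e e′ → coeffwise λ i →
                      trans (coeff-+ f g i)
                        (trans (+-cong (coeff-≈ e i) (coeff-≈ e′ i))
                          (sym (coeff-+ f′ g′ i)))
                  }
                ; assoc = λ f g h → coeffwise λ i → begin
                    coeff (f +ₚ g +ₚ h) i                ≈⟨ coeff-+ (f +ₚ g) h i ⟩
                    coeff (f +ₚ g) i + coeff h i         ≈⟨ +-congʳ (coeff-+ f g i) ⟩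
                    coeff f i + coeff g i + coeff h i    ≈⟨ +-assoc _ _ _ ⟩
                    coeff f i + (coeff g i + coeff h i)  ≈⟨ +-congˡ (coeff-+ g h i) ⟨
                    coeff f i + coeff (g +ₚ h) i         ≈⟨ coeff-+ f (g +ₚ h) i ⟨
                    coeff (f +ₚ (g +ₚ h)) i              ∎
                }
              ; identity = (λ f → coeffwise λ i → refl)
                         , (λ f → coeffwise λ i → trans (coeff-+ f [] i) (+-identityʳ _))
              }
            ; inverse = (λ f → coeffwise λ i →
                          trans (coeff-+ (-ₚ f) f i)
                            (trans (+-congʳ (coeff-neg f i)) (-‿inverseˡ _)))
                      , (λ f → coeffwise λ i →
                          trans (coeff-+ f (-ₚ f) i)
                            (trans (+-congˡ (coeff-neg f i)) (-‿inverseʳ _)))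
            ; ⁻¹-cong = λ {f} {g} e → coeffwise λ i →
                trans (coeff-neg f i)
                  (trans (-‿cong (coeff-≈ e i)) (sym (coeff-neg g i)))
            }
          ; comm = λ f g → coeffwise λ i →
              trans (coeff-+ f g i) (trans (+-comm _ _) (sym (coeff-+ g f i)))
          }
        ; *-cong = λ {f} {f′} {g} {g′} e e′ → coeffwise λ i →
            trans (coeff-* f g i)
              (trans (conv-cong (coeff-≈ e) (coeff-≈ e′) i) (sym (coeff-* f′ g′ i)))
        ; *-assoc = λ f g h → coeffwise λ i → begin
            coeff (f *ₚ g *ₚ h) i
              ≈⟨ coeff-* (f *ₚ g) h i ⟩
            conv (coeff (f *ₚ g)) (coeff h) i
              ≈⟨ conv-cong (coeff-* f g) (λ _ → refl) i ⟩
            conv (conv (coeff f) (coeff g)) (coeff h) i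
              ≈⟨ conv-assoc (coeff f) (coeff g) (coeff h) i ⟩
            conv (coeff f) (conv (coeff g) (coeff h)) i
              ≈⟨ conv-cong (λ _ → refl) (coeff-* g h) i ⟨
            conv (coeff f) (coeff (g *ₚ h)) i
              ≈⟨ coeff-* f (g *ₚ h) i ⟨
            coeff (f *ₚ (g *ₚ h)) i ∎
        ; *-identity = *ₚ-identityˡ
                     , (λ f → coeffwise λ i →
                         trans (coeff-≈ (*ₚ-comm f (const 1#)) i)
                               (coeff-≈ (*ₚ-identityˡ f) i))
        ; distrib = (λ f g h → coeffwise λ i →
                      trans (coeff-≈ (*ₚ-comm f (g +ₚ h)) i)
                        (trans (coeff-≈ (*ₚ-distribʳ f g h) i)
                          (trans (coeff-+ (g *ₚ f) (h *ₚ f) i)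
                            (trans (+-cong (coeff-≈ (*ₚ-comm g f) i)
                                           (coeff-≈ (*ₚ-comm h f) i))
                              (sym (coeff-+ (f *ₚ g) (f *ₚ h) i))))))
                  , *ₚ-distribʳ
        }
      ; *-comm = *ₚ-comm
      }
    }
    where
    *ₚ-comm : ∀ f g → f *ₚ g ≈ₚ g *ₚ f
    *ₚ-comm f g = coeffwise λ i →
      trans (coeff-* f g i)
        (trans (conv-comm (coeff f) (coeff g) i) (sym (coeff-* g f i)))

    *ₚ-identityˡ : ∀ f → const 1# *ₚ f ≈ₚ f
    *ₚ-identityˡ f = coeffwise λ i →
      trans (coeff-* (const 1#) f i) (conv-identityˡ (coeff f) i)

    *ₚ-distribʳ : ∀ h f g → (f +ₚ g) *ₚ h ≈ₚ f *ₚ h +ₚ g *ₚ h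
    *ₚ-distribʳ h f g = coeffwise λ i → begin
      coeff ((f +ₚ g) *ₚ h) i
        ≈⟨ coeff-* (f +ₚ g) h i ⟩
      conv (coeff (f +ₚ g)) (coeff h) i
        ≈⟨ conv-cong (λ j → trans (coeff-+ f g j) (+-congʳ (sym (*-identityˡ _))))
                     (λ _ → refl) i ⟩
      conv (λ j → 1# * coeff f j + coeff g j) (coeff h) i
        ≈⟨ conv-linearˡ 1# (coeff f) (coeff g) (coeff h) i ⟩
      1# * conv (coeff f) (coeff h) i + conv (coeff g) (coeff h) i
        ≈⟨ +-cong (trans (*-identityˡ _) (sym (coeff-* f h i))) (sym (coeff-* g h i)) ⟩
      coeff (f *ₚ h) i + coeff (g *ₚ h) i
        ≈⟨ coeff-+ (f *ₚ h) (g *ₚ h) i ⟨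
      coeff (f *ₚ h +ₚ g *ₚ h) i ∎

module QAnalogue {c ℓ} (R : CommutativeRing c ℓ) (q : CommutativeRing.Carrier R) where
  open Ring R

  [_]q : ℕ → Carrier
  [ m ]q = ∑[ i < m ] (q ^ toℕ i)

  [_]q! : ℕ → Carrier
  [ zero  ]q! = 1#
  [ suc m ]q! = [ suc m ]q * [ m ]q!

  -- B n k is the quotient [n]! / ([k]! [n-k]!).  For the indeterminate q of ℤ[q]
  -- the denominator is nonzero and ℤ[q] is a domain, so this determines B n k
  -- for k ≤ n.
  IsGaussianBinomial : (ℕ → ℕ → Carrier) → Set ℓ
  IsGaussianBinomial B =
    ∀ n k → k ≤ n → B n k * ([ k ]q! * [ n ∸ k ]q!) ≈ [ n ]q!

  private
    qPascal : ℕ → ℕ → Carrier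
    qPascal _       zero    = 1#
    qPascal zero    (suc k) = 0#
    qPascal (suc n) (suc k) = qPascal n k + q ^ suc k * qPascal n (suc k)

    module Solver = NatSolver commutativeSemiring
    open Solver using (solve; _:=_; _:+_; _:*_)
    open SetoidReasoning setoid

    []q-+ : ∀ a b → [ a ℕ.+ b ]q ≈ [ a ]q + q ^ a * [ b ]q
    []q-+ zero    b = sym (trans (+-identityˡ _) (*-identityˡ _))
    []q-+ (suc a) b = begin
      [ suc (a ℕ.+ b) ]q                         ≈⟨ []q-suc (a ℕ.+ b) ⟩
      1# + q * [ a ℕ.+ b ]q                      ≈⟨ +-congˡ (*-congˡ ([]q-+ a b)) ⟩
      1# + q * ([ a ]q + q ^ a * [ b ]q)
        ≈⟨ solve 5 (λ o q x y z → o :+ q :* (x :+ y :* z) := (o :+ q :* x) :+ (q :* y) :* z)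
             refl 1# q [ a ]q (q ^ a) [ b ]q ⟩
      (1# + q * [ a ]q) + q ^ suc a * [ b ]q     ≈⟨ +-congʳ ([]q-suc a) ⟨
      [ suc a ]q + q ^ suc a * [ b ]q            ∎
      where
      []q-suc : ∀ m → [ suc m ]q ≈ 1# + q * [ m ]q
      []q-suc m = +-congˡ (sym (*-distribˡ-sum {m} q (λ i → q ^ toℕ i)))

    qPascal-zero : ∀ n d → qPascal n (suc (d ℕ.+ n)) ≈ 0#
    qPascal-zero zero    d = refl
    qPascal-zero (suc n) d rewrite ℕ.+-suc d n = begin
      qPascal n (suc (d ℕ.+ n)) + q ^ suc (suc (d ℕ.+ n)) * qPascal n (suc (suc d ℕ.+ n))
        ≈⟨ +-cong (qPascal-zero n d) (*-congˡ (qPascal-zero n (suc d))) ⟩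
      0# + q ^ suc (suc (d ℕ.+ n)) * 0#
        ≈⟨ trans (+-identityˡ _) (zeroʳ _) ⟩
      0# ∎

    qPascal-! : ∀ k j → qPascal (k ℕ.+ j) k * ([ k ]q! * [ j ]q!) ≈ [ k ℕ.+ j ]q!
    qPascal-! zero    j = trans (*-identityˡ _) (*-identityˡ _)
    qPascal-! (suc k) zero = begin
      (qPascal n k + qᵏ * qPascal n (suc k)) * ([ suc k ]q * [ k ]q! * 1#)
        ≈⟨ *-congʳ (+-congˡ (*-congˡ top)) ⟩
      (qPascal n k + qᵏ * 0#) * ([ suc k ]q * [ k ]q! * 1#)
        ≈⟨ *-congʳ (trans (+-congˡ (zeroʳ qᵏ)) (+-identityʳ _)) ⟩
      qPascal n k * ([ suc k ]q * [ k ]q! * 1#)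
        ≈⟨ solve 4 (λ g a b o → g :* (a :* b :* o) := a :* (g :* (b :* o)))
             refl (qPascal n k) [ suc k ]q [ k ]q! 1# ⟩
      [ suc k ]q * (qPascal n k * ([ k ]q! * 1#))
        ≈⟨ *-congˡ (qPascal-! k zero) ⟩
      [ suc k ]q * [ n ]q!
        ≈⟨ *-congʳ (reflexive (≡.cong (λ m → [ suc m ]q) (ℕ.+-identityʳ k))) ⟨
      [ suc n ]q * [ n ]q! ∎
      where
      n = k ℕ.+ 0
      qᵏ = q ^ suc k
      top : qPascal n (suc k) ≈ 0#
      top rewrite ℕ.+-identityʳ k = qPascal-zero k 0
    qPascal-! (suc k) (suc j) = begin
      (u + qᵏ * v) * ([ suc k ]q * [ k ]q! * ([ suc j ]q * [ j ]q!))
        ≈⟨ solve 7 (λ u c v a b d e →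
             (u :+ c :* v) :* (a :* b :* (d :* e)) :=
             a :* (u :* (b :* (d :* e))) :+ c :* d :* (v :* (a :* b :* e)))
             refl u qᵏ v [ suc k ]q [ k ]q! [ suc j ]q [ j ]q! ⟩
      [ suc k ]q * (u * ([ k ]q! * [ suc j ]q!)) + qᵏ * [ suc j ]q * (v * ([ suc k ]q! * [ j ]q!))
        ≈⟨ +-cong (*-congˡ (qPascal-! k (suc j))) (*-congˡ right) ⟩
      [ suc k ]q * [ n ]q! + qᵏ * [ suc j ]q * [ n ]q!
        ≈⟨ distribʳ _ _ _ ⟨
      ([ suc k ]q + qᵏ * [ suc j ]q) * [ n ]q!
        ≈⟨ *-congʳ ([]q-+ (suc k) (suc j)) ⟨
      [ suc n ]q * [ n ]q! ∎
      where
      n = k ℕ.+ suc j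
      qᵏ = q ^ suc k
      u = qPascal n k
      v = qPascal n (suc k)
      right : v * ([ suc k ]q! * [ j ]q!) ≈ [ n ]q!
      right rewrite ℕ.+-suc k j = qPascal-! (suc k) j

  gaussianBinomial-exists : ∃ IsGaussianBinomial
  gaussianBinomial-exists = qPascal , λ n k k≤n →
    ≡.subst (λ m → qPascal m k * ([ k ]q! * [ n ∸ k ]q!) ≈ [ m ]q!)
      (ℕ.m+[n∸m]≡n k≤n) (qPascal-! k (n ∸ k))

module Falling {c ℓ} (R : CommutativeRing c ℓ)
  (x : CommutativeRing.Carrier R) (f : ℕ → CommutativeRing.Carrier R) where
  open Ring R

  -- x (x - f 1) ⋯ (x - f (k - 1))
  x↓_ : ℕ → Carrier
  x↓ 0             = 1#
  x↓ 1             = x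
  x↓ suc k@(suc _) = x↓ k * (x - f k)

  module Expansion
    (f-0 : f 0 ≈ 0#) (T : ℕ → ℕ → Carrier)
    (T-0-0 : T 0 0 ≈ 1#)
    (T-0-suc : ∀ k → T 0 (suc k) ≈ 0#)
    (T-suc-0 : ∀ n → T (suc n) 0 ≈ 0#)
    (T-suc-suc : ∀ n k → T (suc n) (suc k) ≈ T n k + f (suc k) * T n (suc k))
    where

    private
      module Solver = NatSolver commutativeSemiring
    open Solver using (solve; _:=_; _:+_; _:*_)
    open SetoidReasoning setoid

    T-zero : ∀ n d → T n (suc (d ℕ.+ n)) ≈ 0#
    T-zero zero    d = T-0-suc _
    T-zero (suc n) d rewrite ℕ.+-suc d n =
      trans (T-suc-suc _ _)
        (trans (+-cong (T-zero n d) (*-congˡ (T-zero n (suc d))))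
          (trans (+-identityˡ _) (zeroʳ _)))

    x*x↓ : ∀ k → x * x↓ k ≈ x↓ suc k + f k * x↓ k
    x*x↓ zero    = begin
      x * 1#             ≈⟨ *-identityʳ x ⟩
      x                  ≈⟨ +-identityʳ x ⟨
      x + 0#             ≈⟨ +-congˡ (trans (*-congʳ f-0) (zeroˡ 1#)) ⟨
      x + f 0 * 1#       ∎
    x*x↓ (suc k) = begin
      x * y                       ≈⟨ *-congʳ (+-identityʳ x) ⟨
      (x + 0#) * y                ≈⟨ *-congʳ (+-congˡ (-‿inverseˡ a)) ⟨
      (x + (- a + a)) * y
        ≈⟨ solve 4 (λ x m a y → (x :+ (m :+ a)) :* y := y :* (x :+ m) :+ a :* y)
             refl x (- a) a y ⟩
      y * (x - a) + a * y         ∎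
      where
      y = x↓ suc k
      a = f (suc k)

    sum-split : ∀ m (g h : ℕ → Carrier) →
      ∑[ k < m ] (g (toℕ k) + h (toℕ k)) ≈ ∑[ k < m ] g (toℕ k) + ∑[ k < m ] h (toℕ k)
    sum-split m g h = ∑-distrib-+ {m} (λ k → g (toℕ k)) (λ k → h (toℕ k))

    sum-snoc : ∀ m (g : ℕ → Carrier) →
      ∑[ k < suc m ] g (toℕ k) ≈ ∑[ k < m ] g (toℕ k) + g m
    sum-snoc m g = begin
      ∑[ k < suc m ] g (toℕ k)
        ≈⟨ sum-init-last {m} (λ k → g (toℕ k)) ⟩
      ∑[ k < m ] g (toℕ (inject₁ k)) + g (toℕ (fromℕ m))
        ≈⟨ +-cong (sum-cong-≋ {m} (λ k → reflexive (≡.cong g (Fin.toℕ-inject₁ k))))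
                  (reflexive (≡.cong g (Fin.toℕ-fromℕ m))) ⟩
      ∑[ k < m ] g (toℕ k) + g m ∎

    expansion : ∀ n → x ^ n ≈ ∑[ k ≤ n ] (T n (toℕ k) * x↓ toℕ k)
    expansion zero    = sym (trans (+-identityʳ _) (trans (*-identityʳ _) T-0-0))
    expansion (suc n) = begin
      x * x ^ n
        ≈⟨ *-congˡ (expansion n) ⟩
      x * (∑[ k ≤ n ] (T n (toℕ k) * x↓ toℕ k))
        ≈⟨ *-distribˡ-sum {suc n} x (λ k → T n (toℕ k) * x↓ toℕ k) ⟩
      ∑[ k ≤ n ] (x * (T n (toℕ k) * x↓ toℕ k))
        ≈⟨ sum-cong-≋ {suc n} (λ k → step (toℕ k)) ⟩
      ∑[ k ≤ n ] (up (toℕ k) + stay (toℕ k))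
        ≈⟨ sum-split (suc n) up stay ⟩
      ∑[ k ≤ n ] up (toℕ k) + ∑[ k ≤ n ] stay (toℕ k)
        ≈⟨ +-congˡ shift ⟩
      ∑[ k ≤ n ] up (toℕ k) + ∑[ k ≤ n ] stay (suc (toℕ k))
        ≈⟨ sum-split (suc n) up (λ k → stay (suc k)) ⟨
      ∑[ k ≤ n ] (up (toℕ k) + stay (suc (toℕ k)))
        ≈⟨ sum-cong-≋ {suc n} (λ k → merge (toℕ k)) ⟩
      ∑[ k ≤ n ] (T (suc n) (suc (toℕ k)) * x↓ suc (toℕ k))
        ≈⟨ +-identityˡ _ ⟨
      0# + ∑[ k ≤ n ] (T (suc n) (suc (toℕ k)) * x↓ suc (toℕ k))
        ≈⟨ +-congʳ (trans (*-congʳ (T-suc-0 n)) (zeroˡ 1#)) ⟨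
      ∑[ k ≤ suc n ] (T (suc n) (toℕ k) * x↓ toℕ k) ∎
      where
      up stay : ℕ → Carrier
      up   k = T n k * x↓ suc k
      stay k = f k * T n k * x↓ k

      step : ∀ k → x * (T n k * x↓ k) ≈ up k + stay k
      step k = begin
        x * (T n k * x↓ k)
          ≈⟨ solve 3 (λ x c y → x :* (c :* y) := c :* (x :* y)) refl x (T n k) (x↓ k) ⟩
        T n k * (x * x↓ k)
          ≈⟨ *-congˡ (x*x↓ k) ⟩
        T n k * (x↓ suc k + f k * x↓ k)
          ≈⟨ solve 4 (λ c y f z → c :* (y :+ f :* z) := c :* y :+ f :* c :* z)
               refl (T n k) (x↓ suc k) (f k) (x↓ k) ⟩
        up k + stay k ∎

      merge : ∀ k → up k + stay (suc k) ≈ T (suc n) (suc k) * x↓ suc k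
      merge k = begin
        T n k * x↓ suc k + f (suc k) * T n (suc k) * x↓ suc k
          ≈⟨ distribʳ (x↓ suc k) _ _ ⟨
        (T n k + f (suc k) * T n (suc k)) * x↓ suc k
          ≈⟨ *-congʳ (T-suc-suc n k) ⟨
        T (suc n) (suc k) * x↓ suc k ∎

      shift : ∑[ k ≤ n ] stay (toℕ k) ≈ ∑[ k ≤ n ] stay (suc (toℕ k))
      shift = begin
        stay 0 + ∑[ k < n ] stay (suc (toℕ k))
          ≈⟨ +-congʳ (trans (*-congʳ (trans (*-congʳ f-0) (zeroˡ _))) (zeroˡ 1#)) ⟩
        0# + ∑[ k < n ] stay (suc (toℕ k))
          ≈⟨ +-comm 0# _ ⟩
        ∑[ k < n ] stay (suc (toℕ k)) + 0#
          ≈⟨ +-congˡ (trans (*-congʳ (trans (*-congˡ (T-zero n 0)) (zeroʳ _))) (zeroˡ _)) ⟨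
        ∑[ k < n ] stay (suc (toℕ k)) + stay (suc n)
          ≈⟨ sum-snoc n (λ k → stay (suc k)) ⟨
        ∑[ k ≤ n ] stay (suc (toℕ k)) ∎

module Poly[q] = Polynomial ℤ.+-*-commutativeRing
module ℤ[q] = Ring Poly[q].polynomialRing

module Poly[p] = Polynomial Poly[q].polynomialRing
module ℤ[q][p] = Ring Poly[p].polynomialRing

module Poly[x] = Polynomial Poly[p].polynomialRing
module ℤ[q][p][x] = Ring Poly[x].polynomialRing

q : ℤ[q].Carrier
q = Poly[q].indeterminate

-- f ∣p^ s is the coefficient of p^s in f.
infixl 9 _∣p^_
_∣p^_ : ℤ[q][p].Carrier → ℕ → ℤ[q].Carrier
_∣p^_ = Poly[p].coeff

open QAnalogue Poly[q].polynomialRing q public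

module _ where
  open ℤ[q][p]

  -- The sequence starts at F 1, and x↓ does not use F 0; its value is the one
  -- that extends the recurrence.
  F : ℕ → Carrier
  F 0 = 0#
  F 1 = Poly[p].const q
  F 2 = Poly[p].const q ^ 2
  F (suc (suc m@(suc _))) =
    Poly[p].const q * F (suc m) + Poly[p].indeterminate * F m

module _ where
  open ℤ[q][p][x]

  private
    C : ℤ[q][p].Carrier → Carrier
    C = Poly[x].const

  open Falling Poly[x].polynomialRing Poly[x].indeterminate (λ k → C (F k)) public
    using (x↓_)

  x : Carrier
  x = Poly[x].indeterminate

  -- Only the entries S n k with k ≤ n matter; they are determined because
  -- x↓ k is monic of degree k.
  IsSf : (ℕ → ℕ → ℤ[q][p].Carrier) → Set
  IsSf S = ∀ n → x ^ n ≈ ∑[ k ≤ n ] (Poly[x].const (S n (toℕ k)) * x↓ toℕ k)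

  private
    S : ℕ → ℕ → ℤ[q][p].Carrier
    S zero    zero    = ℤ[q][p].1#
    S zero    (suc k) = ℤ[q][p].0#
    S (suc n) zero    = ℤ[q][p].0#
    S (suc n) (suc k) = S n k ℤ[q][p].+ F (suc k) ℤ[q][p].* S n (suc k)

    C-0 : C ℤ[q][p].0# ≈ 0#
    C-0 = Poly[x].coeffwise λ { zero → ℤ[q][p].refl ; (suc i) → ℤ[q][p].refl }

    C-+* : ∀ a b c → C (a ℤ[q][p].+ b ℤ[q][p].* c) ≈ C a + C b * C c
    C-+* a b c = Poly[x].coeffwise λ
      { zero    → ℤ[q][p].+-congˡ {a} (ℤ[q][p].sym (ℤ[q][p].+-identityʳ _))
      ; (suc i) → ℤ[q][p].refl }

    open Falling.Expansion Poly[x].polynomialRing x (λ k → C (F k)) C-0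
      (λ n k → C (S n k)) refl (λ _ → C-0) (λ _ → C-0)
      (λ n k → C-+* (S n k) (F (suc k)) (S n (suc k)))

  Sf-exists : ∃ IsSf
  Sf-exists = S , expansion

{-# OPTIONS --safe #-}
module Submission where

-- Since x↓ k is monic of degree k, the Sf n k are uniquely determined, so they
-- satisfy S (n+1) (k+1) = S n k + F (k+1) S n (k+1) and S (k+d) k is the
-- complete homogeneous symmetric polynomial h_d(F₁, …, F_k).  Modulo p² one has
-- F_m = q^m + (m-2) q^(m-2) p for m ≥ 2; this gives h_d(q, …, q^k) at p⁰ and, at p¹, the
-- sum over s of s q^s h_{d-1}(q, …, q^k, q^(s+2)) (derivative in the variable
-- F_{s+2}).  Splitting off the variables q^(s+2), …, q^k turns the latter into
-- a convolution of two Gaussian binomials.  The quotients defining the Gaussian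
-- binomials are unique because [m]q! has constant term 1.

open import Defs using (module Ring; module Polynomial; module QAnalogue; module Falling)
open import Algebra.Bundles using (CommutativeRing)
open import Data.Nat.Base as ℕ using (ℕ; zero; suc; _∸_; _≤_; _<_; s≤s)
open import Data.Fin.Base using (Fin; toℕ)
open import Data.List.Base using ([]; _∷_; map)
open import Data.Product.Base using (proj₁; proj₂; _,_) renaming (_×_ to _∧_)
open import Relation.Nullary using (yes; no)
import Data.Fin.Properties as Fin
import Data.Integer.Properties as ℤ
import Data.Nat.Properties as ℕ
import Relation.Binary.PropositionalEquality as ≡
import Relation.Binary.Reasoning.Setoid as SetoidReasoning
import Algebra.Solver.Ring.NaturalCoefficients.Default as NatSolver

-- Finite sums.

module Sums {c ℓ} (R : CommutativeRing c ℓ) where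
  open Ring R
  open import Algebra.Properties.Semiring.Sum semiring using (sum-replicate-zero)

  ∑-init-last : ∀ m (g : ℕ → Carrier) →
    ∑[ k ≤ m ] g (toℕ k) ≈ ∑[ k < m ] g (toℕ k) + g m
  ∑-init-last m g = trans (sum-init-last {m} (λ k → g (toℕ k)))
    (+-cong (sum-cong-≋ {m} (λ k → reflexive (≡.cong g (Fin.toℕ-inject₁ k))))
            (reflexive (≡.cong g (Fin.toℕ-fromℕ m))))

  ∑-zero : ∀ m {g : Fin m → Carrier} → (∀ i → g i ≈ 0#) → ∑[ i < m ] g i ≈ 0#
  ∑-zero m e = trans (sum-cong-≋ {m} e) (sum-replicate-zero m)

  ∑-linear : ∀ m z (g h : Fin m → Carrier) →
    ∑[ i < m ] (g i + z * h i) ≈ ∑[ i < m ] g i + z * ∑[ i < m ] h i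
  ∑-linear m z g h = trans (∑-distrib-+ {m} g (λ i → z * h i))
    (+-congˡ (sym (*-distribˡ-sum {m} z h)))

-- Complete homogeneous symmetric polynomials in powers of q.

module Triangles {c ℓ} (R : CommutativeRing c ℓ) (q : CommutativeRing.Carrier R) where
  open Ring R
  open Sums R
  open import Algebra.Properties.Semiring.Exp semiring using (^-homo-*)
  open SetoidReasoning setoid
  private module Solver = NatSolver commutativeSemiring
  open Solver using (solve; _:=_; _:+_; _:*_; con)

  -- h m i is the complete homogeneous symmetric polynomial hᵢ(1, q, …, qᵐ).
  h : ℕ → ℕ → Carrier
  h _       zero    = 1#
  h zero    (suc i) = 1#
  h (suc m) (suc i) = h m (suc i) + q ^ suc m * h (suc m) i

  h-zero : ∀ i → h 0 i ≈ 1#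
  h-zero zero    = refl
  h-zero (suc i) = refl

  -- h-double m s d is h_{d-1}(1, q, …, q^{s+m+2}) with the variable q^{s+2}
  -- repeated; the terms separate h(q^{s+2}, …, q^{s+m+2}) from h(1, …, q^{s+2}).
  h-double : ℕ → ℕ → ℕ → Carrier
  h-double m s d =
    ∑[ i < d ] (q ^ (toℕ i ℕ.* (2 ℕ.+ s)) * h m (toℕ i) * h (2 ℕ.+ s) (d ∸ suc (toℕ i)))

  -- Expansion in the second copy of q^(s+2), here the top variable: monomials that avoid the copy
  -- make up the i = 0 term, and one factor q^(s+2) comes out of all the others.
  h-double-zero : ∀ s d → h-double 0 s (suc d) ≈ h (2 ℕ.+ s) d + q ^ (2 ℕ.+ s) * h-double 0 s d
  h-double-zero s d = +-cong
    (trans (*-congʳ (*-identityʳ 1#)) (*-identityˡ _))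
    (trans (sum-cong-≋ {d} (λ i → term (toℕ i)))
      (sym (*-distribˡ-sum {d} (q ^ (2 ℕ.+ s)) (λ i →
        q ^ (toℕ i ℕ.* (2 ℕ.+ s)) * h 0 (toℕ i) * h (2 ℕ.+ s) (d ∸ suc (toℕ i))))))
    where
    term : ∀ i → q ^ (suc i ℕ.* (2 ℕ.+ s)) * h 0 (suc i) * h (2 ℕ.+ s) (d ∸ suc i)
      ≈ q ^ (2 ℕ.+ s) * (q ^ (i ℕ.* (2 ℕ.+ s)) * h 0 i * h (2 ℕ.+ s) (d ∸ suc i))
    term i = begin
      q ^ (2 ℕ.+ s ℕ.+ i ℕ.* (2 ℕ.+ s)) * 1# * z
        ≈⟨ *-congʳ (*-cong (^-homo-* q (2 ℕ.+ s) (i ℕ.* (2 ℕ.+ s))) (sym (h-zero i))) ⟩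
      X * Y * h 0 i * z
        ≈⟨ solve 4 (λ x y w z → x :* y :* w :* z := x :* (y :* w :* z)) refl X Y (h 0 i) z ⟩
      X * (Y * h 0 i * z) ∎
      where
      X = q ^ (2 ℕ.+ s)
      Y = q ^ (i ℕ.* (2 ℕ.+ s))
      z = h (2 ℕ.+ s) (d ∸ suc i)

  -- Expansion in the top variable q^(s+m+3), which is now different from the repeated one. The
  -- recurrence of `h (suc m)` passes through the convolution because q^(m+1) q^(s+2) is that
  -- variable.
  h-double-suc : ∀ m s d →
    h-double (suc m) s (suc d) ≈ h-double m s (suc d) + q ^ (3 ℕ.+ s ℕ.+ m) * h-double (suc m) s d
  h-double-suc m s d = begin
    t 1# + ∑[ i < d ] (q ^ (suc (toℕ i) ℕ.* (2 ℕ.+ s))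
                         * h (suc m) (suc (toℕ i)) * h (2 ℕ.+ s) (d ∸ suc (toℕ i)))
      ≈⟨ +-congˡ (sum-cong-≋ {d} (λ i → term (toℕ i))) ⟩
    t 1# + ∑[ i < d ] (u (toℕ i) + Q * v (toℕ i))
      ≈⟨ +-congˡ (∑-linear d Q (λ i → u (toℕ i)) (λ i → v (toℕ i))) ⟩
    t 1# + (∑[ i < d ] u (toℕ i) + Q * h-double (suc m) s d)
      ≈⟨ +-assoc _ _ _ ⟨
    h-double m s (suc d) + Q * h-double (suc m) s d ∎
    where
    t : Carrier → Carrier
    t y = 1# * y * h (2 ℕ.+ s) d
    Q = q ^ (3 ℕ.+ s ℕ.+ m)
    u v : ℕ → Carrier
    u i = q ^ (suc i ℕ.* (2 ℕ.+ s)) * h m (suc i) * h (2 ℕ.+ s) (d ∸ suc i)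
    v i = q ^ (i ℕ.* (2 ℕ.+ s)) * h (suc m) i * h (2 ℕ.+ s) (d ∸ suc i)
    Q-split : q ^ suc m * q ^ (2 ℕ.+ s) ≈ Q
    Q-split = trans (sym (^-homo-* q (suc m) (2 ℕ.+ s)))
      (reflexive (≡.cong (λ e → q ^ suc e) (ℕ.+-comm m (2 ℕ.+ s))))
    term : ∀ i →
      q ^ (suc i ℕ.* (2 ℕ.+ s)) * h (suc m) (suc i) * h (2 ℕ.+ s) (d ∸ suc i) ≈ u i + Q * v i
    term i = begin
      p * (a + b * e) * w
        ≈⟨ solve 5 (λ p a b e w → p :* (a :+ b :* e) :* w := p :* a :* w :+ p :* b :* e :* w)
             refl p a b e w ⟩
      p * a * w + p * b * e * w
        ≈⟨ +-congˡ (*-congʳ (*-congʳ (*-congʳ (^-homo-* q (2 ℕ.+ s) (i ℕ.* (2 ℕ.+ s)))))) ⟩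
      p * a * w + X * Y * b * e * w
        ≈⟨ +-congˡ (solve 5 (λ x y b e w → x :* y :* b :* e :* w := (b :* x) :* (y :* e :* w))
             refl X Y b e w) ⟩
      p * a * w + (b * X) * (Y * e * w)
        ≈⟨ +-congˡ (*-congʳ Q-split) ⟩
      u i + Q * v i ∎
      where
      X = q ^ (2 ℕ.+ s)
      Y = q ^ (i ℕ.* (2 ℕ.+ s))
      p = q ^ (suc i ℕ.* (2 ℕ.+ s))
      a = h m (suc i)
      b = q ^ suc m
      e = h (suc m) i
      w = h (2 ℕ.+ s) (d ∸ suc i)

  -- Closed forms for the triangles at p^0 (`a`) and at p^1 (`b`).

  module FirstCoefficients (a b : ℕ → ℕ → Carrier)
    (a-00 : a 0 0 ≈ 1#) (a-s0 : ∀ n → a (suc n) 0 ≈ 0#)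
    (a-above : ∀ n → a n (suc n) ≈ 0#)
    (a-ss : ∀ n k → a (suc n) (suc k) ≈ a n k + q ^ suc k * a n (suc k))
    (b-0 : ∀ n → b n 0 ≈ 0#) (b-0s : ∀ k → b 0 (suc k) ≈ 0#)
    (b-above : ∀ n → b n (suc n) ≈ 0#)
    (b-ss : ∀ n k → b (suc n) (suc k) ≈
              b n k + (q ^ suc k * b n (suc k) + (k ∸ 1) × (q ^ (k ∸ 1)) * a n (suc k)))
    where

    a-diagonal : ∀ k → a k k ≈ 1#
    a-diagonal zero    = a-00
    a-diagonal (suc k) = begin
      a (suc k) (suc k)                  ≈⟨ a-ss k k ⟩
      a k k + q ^ suc k * a k (suc k)    ≈⟨ +-cong (a-diagonal k) (*-congˡ (a-above k)) ⟩
      1# + q ^ suc k * 0#                ≈⟨ trans (+-congˡ (zeroʳ _)) (+-identityʳ 1#) ⟩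
      1#                                 ∎

    -- Both sides satisfy the same recurrence in k and d. The factor q^d rescales the variables 1,
    -- ..., q^k of `h k d` to q, ..., q^(k+1).
    a-closed-form : ∀ k d → a (suc k ℕ.+ d) (suc k) ≈ q ^ d * h k d
    a-closed-form k zero rewrite ℕ.+-identityʳ k =
      trans (a-diagonal (suc k)) (sym (*-identityˡ 1#))
    a-closed-form zero (suc d) = begin
      a (2 ℕ.+ d) 1                      ≈⟨ a-ss (suc d) 0 ⟩
      a (suc d) 0 + q ^ 1 * a (suc d) 1
        ≈⟨ +-cong (a-s0 d) (*-congˡ (trans (a-closed-form 0 d)
             (trans (*-congˡ (h-zero d)) (*-identityʳ _)))) ⟩
      0# + q * 1# * q ^ d                ≈⟨ trans (+-identityˡ _) (*-congʳ (*-identityʳ q)) ⟩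
      q * q ^ d                          ≈⟨ *-identityʳ _ ⟨
      q * q ^ d * 1#                     ∎
    a-closed-form (suc k) (suc d) = begin
      a (2 ℕ.+ k ℕ.+ suc d) (2 ℕ.+ k)
        ≈⟨ a-ss (suc k ℕ.+ suc d) (suc k) ⟩
      a (suc k ℕ.+ suc d) (suc k) + Q * a (suc k ℕ.+ suc d) (2 ℕ.+ k)
        ≈⟨ +-cong (a-closed-form k (suc d))
             (*-congˡ (trans (reflexive (≡.cong (λ n → a n (2 ℕ.+ k)) (ℕ.+-suc (suc k) d)))
                             (a-closed-form (suc k) d))) ⟩
      q * q ^ d * h k (suc d) + q * q ^ suc k * (q ^ d * h (suc k) d)
        ≈⟨ solve 5 (λ q x y z w → q :* x :* y :+ q :* z :* (x :* w) := q :* x :* (y :+ z :* w))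
             refl q (q ^ d) (h k (suc d)) (q ^ suc k) (h (suc k) d) ⟩
      q ^ suc d * h (suc k) (suc d) ∎
      where Q = q ^ (2 ℕ.+ k)

    private
      -- Truncated subtraction makes the hypothesis hold for k = 0 and k = 1, the columns belonging
      -- to F_1 and F_2, which contain no p; the source term of `b-ss` then vanishes.
      b-ss-0 : ∀ n k → k ∸ 1 ≡.≡ 0 → b n k ≈ 0# → b n (suc k) ≈ 0# → b (suc n) (suc k) ≈ 0#
      b-ss-0 n k k≡0 e e′ = begin
        b (suc n) (suc k)
          ≈⟨ b-ss n k ⟩
        b n k + (q ^ suc k * b n (suc k) + (k ∸ 1) × (q ^ (k ∸ 1)) * a n (suc k))
          ≈⟨ +-cong e (+-cong (*-congˡ e′) 
               (*-congʳ (reflexive (≡.cong (λ m → m × (q ^ m)) k≡0)))) ⟩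
        0# + (q ^ suc k * 0# + 0# * a n (suc k))
          ≈⟨ solve 2 (λ x y → con 0 :+ (x :* con 0 :+ con 0 :* y) := con 0)
               refl (q ^ suc k) (a n (suc k)) ⟩
        0# ∎

    b-1 : ∀ n → b n 1 ≈ 0#
    b-1 zero    = b-0s 0
    b-1 (suc n) = b-ss-0 n 0 ≡.refl (b-0 n) (b-1 n)

    b-2 : ∀ n → b n 2 ≈ 0#
    b-2 zero    = b-0s 1
    b-2 (suc n) = b-ss-0 n 1 ≡.refl (b-1 n) (b-2 n)

    b-diagonal : ∀ k → b k k ≈ 0#
    b-diagonal zero    = b-0 0
    b-diagonal (suc k) = begin
      b (suc k) (suc k)
        ≈⟨ b-ss k k ⟩
      b k k + (q ^ suc k * b k (suc k) + K * a k (suc k))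
        ≈⟨ +-cong (b-diagonal k) (+-cong (*-congˡ (b-above k)) (*-congˡ (a-above k))) ⟩
      0# + (q ^ suc k * 0# + K * 0#)
        ≈⟨ solve 2 (λ x y → con 0 :+ (x :* con 0 :+ y :* con 0) := con 0) refl (q ^ suc k) K ⟩
      0# ∎
      where K = (k ∸ 1) × (q ^ (k ∸ 1))

    private
      -- `q * w j` is the coefficient of p in F_(j+3).
      w : ℕ → Carrier
      w j = suc j × (q ^ j)

      q*w : ∀ j → q * w j ≈ suc j × (q ^ suc j)
      q*w j = ×-comm-* (suc j) q (q ^ j)
        where open import Algebra.Properties.Semiring.Mult semiring using (×-comm-*)

    -- Writing r = k - 2 and s = suc j, the inner sum of the theorem is
    -- h-double (k - s - 2) (s - 1) (n - k).
    b-sum : ℕ → ℕ → Carrier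
    b-sum r d = ∑[ j < r ] (w (toℕ j) * h-double (r ∸ suc (toℕ j)) (toℕ j) d)

    -- Every summand on the left has top variable q^(r+2), and each is expanded in it. For j < r it
    -- differs from the repeated variable and `h-double-suc` applies; for j = r it is the repeated
    -- variable, and `h-double-zero` produces the extra term `w r * h (2 + r) d`.
    b-sum-suc : ∀ r d → b-sum (suc r) (suc d) ≈
      b-sum r (suc d) + q ^ (2 ℕ.+ r) * b-sum (suc r) d + w r * h (2 ℕ.+ r) d
    b-sum-suc r d = begin
      b-sum (suc r) (suc d)
        ≈⟨ ∑-init-last r (λ j → w j * h-double (r ∸ j) j (suc d)) ⟩
      ∑[ j < r ] (w (toℕ j) * h-double (r ∸ toℕ j) (toℕ j) (suc d))
          + w r * h-double (r ∸ r) r (suc d)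
        ≈⟨ +-cong (trans (sum-cong-≋ {r} (λ j → step (toℕ j) (Fin.toℕ<n j)))
                       (∑-linear r Q (λ j → u (toℕ j)) (λ j → v (toℕ j))))
                last ⟩
      b-sum r (suc d) + Q * V + (w r * h (2 ℕ.+ r) d + Q * v r)
        ≈⟨ solve 5 (λ x y z a b → x :+ y :* z :+ (a :+ y :* b) := x :+ y :* (z :+ b) :+ a)
             refl (b-sum r (suc d)) Q V (w r * h (2 ℕ.+ r) d) (v r) ⟩
      b-sum r (suc d) + Q * (V + v r) + w r * h (2 ℕ.+ r) d
        ≈⟨ +-congʳ (+-congˡ (*-congˡ (∑-init-last r v))) ⟨
      b-sum r (suc d) + Q * b-sum (suc r) d + w r * h (2 ℕ.+ r) d ∎
      where
      Q = q ^ (2 ℕ.+ r)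
      u v : ℕ → Carrier
      u j = w j * h-double (r ∸ suc j) j (suc d)
      v j = w j * h-double (r ∸ j) j d
      V = ∑[ j < r ] v (toℕ j)

      push : ∀ j x y z → w j * (x + y * z) ≈ w j * x + y * (w j * z)
      push j = solve 4 (λ w x y z → w :* (x :+ y :* z) := w :* x :+ y :* (w :* z)) refl (w j)

      last : w r * h-double (r ∸ r) r (suc d) ≈ w r * h (2 ℕ.+ r) d + Q * v r
      last rewrite ℕ.n∸n≡0 r = trans (*-congˡ (h-double-zero r d)) (push r _ _ _)

      step : ∀ j → j < r → w j * h-double (r ∸ j) j (suc d) ≈ u j + Q * v j
      step j j<r rewrite ℕ.+-∸-assoc 1 j<r =
        trans (*-congˡ (h-double-suc (r ∸ suc j) j d))
          (trans (push j _ _ _)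
            (+-congˡ (*-congʳ (reflexive (≡.cong (λ e → q ^ (2 ℕ.+ e)) (ℕ.m+[n∸m]≡n j<r))))))

    -- Induction on r and d, with column 2 and the diagonal as zero boundary values. Once
    -- `a-closed-form` is inserted in the source term of `b-ss`, the recurrence is `b-sum-suc`
    -- multiplied by q^(d+1).
    b-closed-form : ∀ r d → b (2 ℕ.+ r ℕ.+ d) (2 ℕ.+ r) ≈ q ^ d * b-sum r d
    b-closed-form zero d = trans (b-2 (2 ℕ.+ d)) (sym (zeroʳ _))
    b-closed-form (suc r) zero rewrite ℕ.+-identityʳ r =
      trans (b-diagonal (3 ℕ.+ r))
        (sym (trans (*-identityˡ _) (∑-zero (suc r) (λ j → zeroʳ (w (toℕ j))))))
    b-closed-form (suc r) (suc d) = begin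
      b (suc n) (3 ℕ.+ r)
        ≈⟨ b-ss n (2 ℕ.+ r) ⟩
      b n (2 ℕ.+ r) + (q * Q * b n (3 ℕ.+ r) + suc r × (q ^ suc r) * a n (3 ℕ.+ r))
        -- In the source term, `q*w` releases the one factor q missing from q^d.
        ≈⟨ +-cong (b-closed-form r (suc d)) (+-cong (*-congˡ eb) (*-cong (sym (q*w r)) ea)) ⟩
      q * q ^ d * b-sum r (suc d) +
        (q * Q * (q ^ d * b-sum (suc r) d) + q * w r * (q ^ d * h (2 ℕ.+ r) d))
        ≈⟨ solve 7 (λ q x a y b z e → q :* x :* a :+ (q :* y :* (x :* b) :+ q :* z :* (x :* e))
                                   := q :* x :* (a :+ y :* b :+ z :* e))
             refl q (q ^ d) (b-sum r (suc d)) Q (b-sum (suc r) d) (w r) (h (2 ℕ.+ r) d) ⟩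
      q * q ^ d * (b-sum r (suc d) + Q * b-sum (suc r) d + w r * h (2 ℕ.+ r) d)
        ≈⟨ *-congˡ (b-sum-suc r d) ⟨
      q ^ suc d * b-sum (suc r) (suc d) ∎
      where
      Q = q ^ (2 ℕ.+ r)
      n = 2 ℕ.+ r ℕ.+ suc d
      n≡ : n ≡.≡ 3 ℕ.+ r ℕ.+ d
      n≡ = ℕ.+-suc (2 ℕ.+ r) d
      ea : a n (3 ℕ.+ r) ≈ q ^ d * h (2 ℕ.+ r) d
      ea = trans (reflexive (≡.cong (λ m → a m (3 ℕ.+ r)) n≡)) (a-closed-form (2 ℕ.+ r) d)
      eb : b n (3 ℕ.+ r) ≈ q ^ d * b-sum (suc r) d
      eb = trans (reflexive (≡.cong (λ m → b m (3 ℕ.+ r)) n≡)) (b-closed-form (suc r) d)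

-- Coefficients of polynomial products, and cancellation.

module Coefficients {c ℓ} (R : CommutativeRing c ℓ) where
  open CommutativeRing R hiding (zero)
  open Polynomial R
  open SetoidReasoning setoid
  private
    module P = Ring polynomialRing
  open P using (sum-syntax; sum⁺-syntax)
  open import Algebra.Properties.Group +-group using ()
    renaming (∙-cancelʳ to +-cancelʳ)

  coeff-map : ∀ a f i → coeff (map (a *_) f) i ≈ a * coeff f i
  coeff-map a []      i       = sym (zeroʳ a)
  coeff-map a (b ∷ f) zero    = refl
  coeff-map a (b ∷ f) (suc i) = coeff-map a f i

  coeff-∷*-zero : ∀ a f g → coeff ((a ∷ f) *ₚ g) 0 ≈ a * coeff g 0
  coeff-∷*-zero a f g = trans (coeff-+ (map (a *_) g) _ 0)
    (trans (+-identityʳ _) (coeff-map a g 0))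

  coeff-∷*-suc : ∀ a f g i →
    coeff ((a ∷ f) *ₚ g) (suc i) ≈ a * coeff g (suc i) + coeff (f *ₚ g) i
  coeff-∷*-suc a f g i = trans (coeff-+ (map (a *_) g) _ (suc i))
    (+-congʳ (coeff-map a g (suc i)))

  coeff-*-0 : ∀ f g → coeff (f *ₚ g) 0 ≈ coeff f 0 * coeff g 0
  coeff-*-0 []      g = sym (zeroˡ _)
  coeff-*-0 (a ∷ f) g = coeff-∷*-zero a f g

  coeff-*-1 : ∀ f g → coeff (f *ₚ g) 1 ≈ coeff f 0 * coeff g 1 + coeff f 1 * coeff g 0
  coeff-*-1 []      g = sym (trans (+-cong (zeroˡ _) (zeroˡ _)) (+-identityˡ 0#))
  coeff-*-1 (a ∷ f) g = trans (coeff-∷*-suc a f g 0) (+-congˡ (coeff-*-0 f g))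

  coeff-const* : ∀ a f i → coeff (const a *ₚ f) i ≈ a * coeff f i
  coeff-const* a f zero    = coeff-∷*-zero a [] f
  coeff-const* a f (suc i) = trans (coeff-∷*-suc a [] f i) (+-identityʳ _)

  coeff-X*-zero : ∀ f → coeff (indeterminate *ₚ f) 0 ≈ 0#
  coeff-X*-zero f = trans (coeff-∷*-zero 0# (const 1#) f) (zeroˡ _)

  coeff-X*-suc : ∀ f i → coeff (indeterminate *ₚ f) (suc i) ≈ coeff f i
  coeff-X*-suc f i = begin
    coeff (indeterminate *ₚ f) (suc i)                 ≈⟨ coeff-∷*-suc 0# (const 1#) f i ⟩
    0# * coeff f (suc i) + coeff (const 1# *ₚ f) i     ≈⟨ +-cong (zeroˡ _) (coeff-const* 1# f i) ⟩
    0# + 1# * coeff f i                                ≈⟨ trans (+-identityˡ _) (*-identityˡ _) ⟩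
    coeff f i                                          ∎

  -- As g has constant term 1, the product has the same constant term as f, so that term is 0.
  -- Dropping it leaves the same situation one degree lower. This works over any commutative
  -- coefficient ring.
  *-zero-cancelʳ : ∀ f g → coeff g 0 ≈ 1# → f *ₚ g ≈ₚ [] → ∀ i → coeff f i ≈ 0#
  *-zero-cancelʳ []      g _  _ i = refl
  *-zero-cancelʳ (a ∷ f) g g₀ e = λ where
      zero    → a≈0
      (suc i) → *-zero-cancelʳ f g g₀ (coeffwise f*g≈0) i
    where
    a≈0 : a ≈ 0#
    a≈0 = begin
      a                          ≈⟨ *-identityʳ a ⟨
      a * 1#                     ≈⟨ *-congˡ g₀ ⟨
      a * coeff g 0              ≈⟨ coeff-∷*-zero a f g ⟨
      coeff ((a ∷ f) *ₚ g) 0     ≈⟨ coeff-≈ e 0 ⟩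
      0#                         ∎
    f*g≈0 : ∀ i → coeff (f *ₚ g) i ≈ 0#
    f*g≈0 i = begin
      coeff (f *ₚ g) i                           ≈⟨ +-identityˡ _ ⟨
      0# + coeff (f *ₚ g) i                      ≈⟨ +-congʳ (trans (*-congʳ a≈0) (zeroˡ _)) ⟨
      a * coeff g (suc i) + coeff (f *ₚ g) i     ≈⟨ coeff-∷*-suc a f g i ⟨
      coeff ((a ∷ f) *ₚ g) (suc i)               ≈⟨ coeff-≈ e (suc i) ⟩
      0#                                         ∎

  *-cancelʳ : ∀ f g k → coeff k 0 ≈ 1# → f *ₚ k ≈ₚ g *ₚ k → f ≈ₚ g
  *-cancelʳ f g k k₀ e = x-y≈0⇒x≈yₚ f g
    (coeffwise (*-zero-cancelʳ (f P.- g) k k₀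
      (P.trans (P.distribʳ k f (-ₚ g))
        (P.trans (P.+-cong e (P.sym (-‿distribˡ-* g k))) (P.-‿inverseʳ (g *ₚ k))))))
    where
    open import Algebra.Properties.Group P.+-group using ()
      renaming (x∙y⁻¹≈ε⇒x≈y to x-y≈0⇒x≈yₚ)
    open import Algebra.Properties.Ring P.ring using (-‿distribˡ-*)

  -- Uniqueness of expansions in a family with one monic polynomial per degree.

  module MonicFamily (e : ℕ → Poly)
    (e-monic : ∀ k → coeff (e k) k ≈ 1#) (e-degree : ∀ {k i} → k < i → coeff (e k) i ≈ 0#)
    where

    combination : (ℕ → Carrier) → ℕ → Poly
    combination u m = ∑[ k < m ] (const (u (toℕ k)) *ₚ e (toℕ k))

    combination-suc : ∀ u m i →
      coeff (combination u (suc m)) i ≈ coeff (combination u m) i + u m * coeff (e m) i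
    combination-suc u m i = begin
      coeff (combination u (suc m)) i
        ≈⟨ coeff-≈ (Sums.∑-init-last polynomialRing m (λ k → const (u k) *ₚ e k)) i ⟩
      coeff (combination u m +ₚ const (u m) *ₚ e m) i
        ≈⟨ coeff-+ (combination u m) _ i ⟩
      coeff (combination u m) i + coeff (const (u m) *ₚ e m) i
        ≈⟨ +-congˡ (coeff-const* (u m) (e m) i) ⟩
      coeff (combination u m) i + u m * coeff (e m) i ∎

    combination-degree : ∀ u m {i} → m ≤ i → coeff (combination u m) i ≈ 0#
    combination-degree u zero    _   = refl
    combination-degree u (suc m) {i} m<i = begin
      coeff (combination u (suc m)) i                  ≈⟨ combination-suc u m i ⟩
      coeff (combination u m) i + u m * coeff (e m) i
        ≈⟨ +-cong (combination-degree u m (ℕ.<⇒≤ m<i)) (*-congˡ (e-degree m<i)) ⟩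
      0# + u m * 0#                                    ≈⟨ trans (+-identityˡ _) (zeroʳ _) ⟩
      0#                                               ∎

    combination-leading : ∀ u m → coeff (combination u (suc m)) m ≈ u m
    combination-leading u m = begin
      coeff (combination u (suc m)) m                  ≈⟨ combination-suc u m m ⟩
      coeff (combination u m) m + u m * coeff (e m) m
        ≈⟨ +-cong (combination-degree u m ℕ.≤-refl) (*-congˡ (e-monic m)) ⟩
      0# + u m * 1#                                    ≈⟨ trans (+-identityˡ _) (*-identityʳ _) ⟩
      u m                                              ∎

    leading-unique : ∀ u v m → combination u (suc m) ≈ₚ combination v (suc m) → u m ≈ v m
    leading-unique u v m eq = begin
      u m                                ≈⟨ combination-leading u m ⟨
      coeff (combination u (suc m)) m    ≈⟨ coeff-≈ eq m ⟩
      coeff (combination v (suc m)) m    ≈⟨ combination-leading v m ⟩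
      v m                                ∎

    -- Downward elimination: the top degree is reached only by the last member of the family, which
    -- fixes the last coefficient; that term is then cancelled from both sides.
    coefficients-unique : ∀ u v m → combination u m ≈ₚ combination v m →
      ∀ {k} → k < m → u k ≈ v k
    coefficients-unique u v (suc m) eq {k} k<1+m with k ℕ.≟ m
    ... | yes ≡.refl = leading-unique u v m eq
    ... | no k≢m = coefficients-unique u v m (coeffwise lower) (ℕ.≤∧≢⇒< (ℕ.s≤s⁻¹ k<1+m) k≢m)
      where
      lower : ∀ i → coeff (combination u m) i ≈ coeff (combination v m) i
      lower i = +-cancelʳ _ _ _ (begin
        coeff (combination u m) i + u m * coeff (e m) i    ≈⟨ combination-suc u m i ⟨
        coeff (combination u (suc m)) i                    ≈⟨ coeff-≈ eq i ⟩
        coeff (combination v (suc m)) i                    ≈⟨ combination-suc v m i ⟩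
        coeff (combination v m) i + v m * coeff (e m) i
          ≈⟨ +-congˡ (*-congʳ (leading-unique u v m eq)) ⟨
        coeff (combination v m) i + u m * coeff (e m) i    ∎)

  -- Falling factorials as a monic family.

  module FallingFactorial (f : ℕ → Carrier) where
    open Falling polynomialRing indeterminate (λ k → const (f k)) using (x↓_)

    private
      coeff-*[X-f] : ∀ g a i →
        coeff (g *ₚ (indeterminate P.- const a)) i ≈ coeff (indeterminate *ₚ g) i + - a * coeff g i
      coeff-*[X-f] g a i = begin
        coeff (g *ₚ (indeterminate +ₚ const (- a))) i
          ≈⟨ coeff-≈ (P.trans (P.*-comm g (indeterminate +ₚ const (- a)))
               (P.distribʳ g indeterminate (const (- a)))) i ⟩
        coeff (indeterminate *ₚ g +ₚ const (- a) *ₚ g) i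
          ≈⟨ coeff-+ (indeterminate *ₚ g) _ i ⟩
        coeff (indeterminate *ₚ g) i + coeff (const (- a) *ₚ g) i
          ≈⟨ +-congˡ (coeff-const* (- a) g i) ⟩
        coeff (indeterminate *ₚ g) i + - a * coeff g i ∎

    x↓-degree : ∀ {k i} → k < i → coeff (x↓ k) i ≈ 0#
    x↓-degree {0}             {suc i}       _ = refl
    x↓-degree {1}             {1}           (s≤s ())
    x↓-degree {1}             {suc (suc i)} _ = refl
    x↓-degree {suc k@(suc _)} {suc i} (s≤s k<i) = begin
      coeff (x↓ suc k) (suc i)
        ≈⟨ coeff-*[X-f] (x↓ k) (f k) (suc i) ⟩
      coeff (indeterminate *ₚ x↓ k) (suc i) + - f k * coeff (x↓ k) (suc i)
        ≈⟨ +-cong (trans (coeff-X*-suc (x↓ k) i) (x↓-degree {k} k<i))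
                  (*-congˡ (x↓-degree {k} (ℕ.m<n⇒m<1+n k<i))) ⟩
      0# + - f k * 0#
        ≈⟨ trans (+-identityˡ _) (zeroʳ _) ⟩
      0# ∎

    x↓-monic : ∀ k → coeff (x↓ k) k ≈ 1#
    x↓-monic 0                 = refl
    x↓-monic 1                 = refl
    x↓-monic (suc k@(suc _)) = begin
      coeff (x↓ suc k) (suc k)
        ≈⟨ coeff-*[X-f] (x↓ k) (f k) (suc k) ⟩
      coeff (indeterminate *ₚ x↓ k) (suc k) + - f k * coeff (x↓ k) (suc k)
        ≈⟨ +-cong (trans (coeff-X*-suc (x↓ k) k) (x↓-monic k))
                  (*-congˡ (x↓-degree {k} ℕ.≤-refl)) ⟩
      1# + - f k * 0#
        ≈⟨ trans (+-congˡ (zeroʳ _)) (+-identityʳ _) ⟩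
      1# ∎

    open MonicFamily x↓_ x↓-monic (λ {k} → x↓-degree {k}) public using (coefficients-unique)

-- Gaussian binomials as complete homogeneous symmetric polynomials.

module GaussianBinomials {c ℓ} (R : CommutativeRing c ℓ) where
  open Polynomial R
  open Coefficients R
  open QAnalogue polynomialRing indeterminate
  open Ring polynomialRing
  open SetoidReasoning setoid
  open Triangles polynomialRing indeterminate using (h)
  private module R = CommutativeRing R

  -- Makes q-factorials cancellable through `*-cancelʳ`: for m ≥ 1, `[ m ]q` is 1 plus a multiple of
  -- the indeterminate.
  []q!-constant : ∀ m → coeff [ m ]q! 0 R.≈ R.1#
  []q!-constant zero    = R.refl
  []q!-constant (suc m) =
    R.trans (coeff-*-0 [ suc m ]q [ m ]q!)
      (R.trans (R.*-cong []q-constant ([]q!-constant m)) (R.*-identityˡ R.1#))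
    where
    []q-constant : coeff [ suc m ]q 0 R.≈ R.1#
    []q-constant = R.trans (coeff-+ 1# (∑[ i < m ] (indeterminate ^ suc (toℕ i))) 0)
      (R.trans (R.+-congˡ (R.trans
          (coeff-≈ (sym (*-distribˡ-sum {m} indeterminate (λ i → indeterminate ^ toℕ i))) 0)
          (coeff-X*-zero (∑[ i < m ] (indeterminate ^ toℕ i)))))
        (R.+-identityʳ R.1#))

  []q!*[]q!-cancelʳ : ∀ f g k j → f * ([ k ]q! * [ j ]q!) ≈ g * ([ k ]q! * [ j ]q!) → f ≈ g
  []q!*[]q!-cancelʳ f g k j = *-cancelʳ f g ([ k ]q! * [ j ]q!)
    (R.trans (coeff-*-0 [ k ]q! [ j ]q!)
      (R.trans (R.*-cong ([]q!-constant k) ([]q!-constant j)) (R.*-identityˡ R.1#)))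

  private
    -- The existence witness is a q-Pascal triangle, so the rule B (n+1) (k+1) = B n k + q^(k+1) B n
    -- (k+1) holds by computation.
    B : ℕ → ℕ → Carrier
    B = proj₁ gaussianBinomial-exists

    B-Gaussian : IsGaussianBinomial B
    B-Gaussian = proj₂ gaussianBinomial-exists

    B-diagonal : ∀ n → B n n ≈ 1#
    B-diagonal n = []q!*[]q!-cancelʳ (B n n) 1# n (n ∸ n) (begin
      B n n * ([ n ]q! * [ n ∸ n ]q!)    ≈⟨ B-Gaussian n n ℕ.≤-refl ⟩
      [ n ]q!                            ≈⟨ trans (*-identityˡ _) (*-identityʳ _) ⟨
      1# * ([ n ]q! * 1#)                ≡⟨ ≡.cong (λ d → 1# * ([ n ]q! * [ d ]q!)) (ℕ.n∸n≡0 n) ⟨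
      1# * ([ n ]q! * [ n ∸ n ]q!)       ∎)

    -- The q-Pascal rule for `B` has the same shape as the recurrence that removes the last variable
    -- q^(m+1) from `h (suc m)`.
    B-h : ∀ m i → B (m ℕ.+ i) m ≈ h m i
    B-h m zero rewrite ℕ.+-identityʳ m = B-diagonal m
    B-h zero    (suc i) = refl
    B-h (suc m) (suc i) = +-cong (B-h m (suc i)) (*-congˡ {indeterminate ^ suc m}
      (trans (reflexive (≡.cong (λ n → B n (suc m)) (ℕ.+-suc m i))) (B-h (suc m) i)))

  module _ (qbinom : ℕ → ℕ → Carrier) (isGaussian : IsGaussianBinomial qbinom) where

    qbinom-lower : ∀ m i → qbinom (m ℕ.+ i) m ≈ h m i
    qbinom-lower m i = trans
      ([]q!*[]q!-cancelʳ _ _ m (m ℕ.+ i ∸ m)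
        (trans (isGaussian (m ℕ.+ i) m (ℕ.m≤m+n m i))
          (sym (B-Gaussian (m ℕ.+ i) m (ℕ.m≤m+n m i)))))
      (B-h m i)

    -- Serves the binomial whose lower index is the summation index i. The symmetry comes from the
    -- defining equation: the two factorials in the denominator commute.
    qbinom-upper : ∀ m i → qbinom (m ℕ.+ i) i ≈ h m i
    qbinom-upper m i = trans ([]q!*[]q!-cancelʳ _ _ i m (begin
        qbinom (m ℕ.+ i) i * ([ i ]q! * [ m ]q!)
          ≡⟨ ≡.cong (λ d → qbinom (m ℕ.+ i) i * ([ i ]q! * [ d ]q!)) (ℕ.m+n∸n≡m m i) ⟨
        qbinom (m ℕ.+ i) i * ([ i ]q! * [ m ℕ.+ i ∸ i ]q!)
          ≈⟨ isGaussian (m ℕ.+ i) i (ℕ.m≤n+m i m) ⟩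
        [ m ℕ.+ i ]q!
          ≈⟨ B-Gaussian (m ℕ.+ i) m (ℕ.m≤m+n m i) ⟨
        B (m ℕ.+ i) m * ([ m ]q! * [ m ℕ.+ i ∸ m ]q!)
          ≡⟨ ≡.cong (λ d → B (m ℕ.+ i) m * ([ m ]q! * [ d ]q!)) (ℕ.m+n∸m≡n m i) ⟩
        B (m ℕ.+ i) m * ([ m ]q! * [ i ]q!)
          ≈⟨ *-congˡ {B (m ℕ.+ i) m} (*-comm [ m ]q! [ i ]q!) ⟩
        B (m ℕ.+ i) m * ([ i ]q! * [ m ]q!) ∎))
      (B-h m i)

-- The coefficients of p^0 and p^1 in F and in the Stirling triangle.

open import Defs

module _ where
  open ℤ[q]
  open SetoidReasoning setoid
  open Coefficients Poly[q].polynomialRing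
  open import Algebra.Properties.Semiring.Mult semiring using (×-comm-*)
  private
    module P = Poly[p]

  ∣p^0-F : ∀ m → F (suc m) ∣p^ 0 ≈ q ^ suc m
  ∣p^0-F 0 = sym (*-identityʳ q)
  ∣p^0-F 1 = begin
    F 2 ∣p^ 0
      ≈⟨ coeff-const* q (P.const q ℤ[q][p].* ℤ[q][p].1#) 0 ⟩
    q * ((P.const q ℤ[q][p].* ℤ[q][p].1#) ∣p^ 0)
      ≈⟨ *-congˡ {q} (coeff-const* q ℤ[q][p].1# 0) ⟩
    q ^ 2 ∎
  ∣p^0-F (suc (suc m)) = begin
    F (3 ℕ.+ m) ∣p^ 0
      ≈⟨ P.coeff-+ (P.const q P.*ₚ F (2 ℕ.+ m)) (P.indeterminate P.*ₚ F (suc m)) 0 ⟩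
    (P.const q P.*ₚ F (2 ℕ.+ m)) ∣p^ 0 + (P.indeterminate P.*ₚ F (suc m)) ∣p^ 0
      ≈⟨ +-cong (coeff-const* q (F (2 ℕ.+ m)) 0) (coeff-X*-zero (F (suc m))) ⟩
    q * (F (2 ℕ.+ m) ∣p^ 0) + 0#
      ≈⟨ +-identityʳ (q * (F (2 ℕ.+ m) ∣p^ 0)) ⟩
    q * (F (2 ℕ.+ m) ∣p^ 0)
      ≈⟨ *-congˡ {q} (∣p^0-F (suc m)) ⟩
    q ^ (3 ℕ.+ m) ∎

  -- Each step of the recurrence multiplies by q and adds one more q^(m+1), the p^0 part of the F
  -- two places back. Truncated subtraction gives the value 0 for both F 1 and F 2.
  ∣p^1-F : ∀ k → F (suc k) ∣p^ 1 ≈ (k ∸ 1) × (q ^ (k ∸ 1))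
  ∣p^1-F 0 = refl
  ∣p^1-F 1 = begin
    F 2 ∣p^ 1
      ≈⟨ coeff-const* q (P.const q ℤ[q][p].* ℤ[q][p].1#) 1 ⟩
    q * ((P.const q ℤ[q][p].* ℤ[q][p].1#) ∣p^ 1)
      ≈⟨ *-congˡ {q} (coeff-const* q ℤ[q][p].1# 1) ⟩
    q * (q * 0#)
      ≈⟨ *-congˡ {q} (zeroʳ q) ⟩
    q * 0#
      ≈⟨ zeroʳ q ⟩
    0# ∎
  ∣p^1-F (suc (suc m)) = begin
    F (3 ℕ.+ m) ∣p^ 1
      ≈⟨ P.coeff-+ (P.const q P.*ₚ F (2 ℕ.+ m)) (P.indeterminate P.*ₚ F (suc m)) 1 ⟩
    (P.const q P.*ₚ F (2 ℕ.+ m)) ∣p^ 1 + (P.indeterminate P.*ₚ F (suc m)) ∣p^ 1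
      ≈⟨ +-cong (coeff-const* q (F (2 ℕ.+ m)) 1) (coeff-X*-suc (F (suc m)) 0) ⟩
    q * (F (2 ℕ.+ m) ∣p^ 1) + F (suc m) ∣p^ 0
      ≈⟨ +-cong (*-congˡ {q} (∣p^1-F (suc m))) (∣p^0-F m) ⟩
    q * (m × (q ^ m)) + q ^ suc m
      ≈⟨ +-congʳ {q ^ suc m} (×-comm-* m q (q ^ m)) ⟩
    m × (q ^ suc m) + q ^ suc m
      ≈⟨ +-comm (m × (q ^ suc m)) (q ^ suc m) ⟩
    suc m × (q ^ suc m) ∎

  S : ℕ → ℕ → ℤ[q][p].Carrier
  S = proj₁ Sf-exists

  S-above : ∀ n → S n (suc n) P.≈ₚ ℤ[q][p].0#
  -- Vanishing above the diagonal follows from the recurrence alone, which holds by definition of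
  -- `S`; 0 serves as the point of the expansion.
  S-above n = Falling.Expansion.T-zero P.polynomialRing ℤ[q][p].0# F
    ℤ[q][p].refl S ℤ[q][p].refl (λ _ → ℤ[q][p].refl) (λ _ → ℤ[q][p].refl)
    (λ _ _ → ℤ[q][p].refl) n 0

  -- Reduces the theorem to `S`, whose recurrence is definitional: both triangles expand x^n in the
  -- same monic family.
  S-unique : ∀ Sf → IsSf Sf → ∀ {n k} → k ≤ n → Sf n k P.≈ₚ S n k
  S-unique Sf isSf {n} k≤n =
    Coefficients.FallingFactorial.coefficients-unique P.polynomialRing F (Sf n) (S n) (suc n)
      (ℤ[q][p][x].trans (ℤ[q][p][x].sym (isSf n)) (proj₂ Sf-exists n)) (s≤s k≤n)

  S-0-1 : ∀ n → S n 0 ∣p^ 1 ≈ 0#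
  S-0-1 zero    = refl
  S-0-1 (suc n) = refl

  S-suc-0 : ∀ n k → S (suc n) (suc k) ∣p^ 0 ≈ S n k ∣p^ 0 + q ^ suc k * (S n (suc k) ∣p^ 0)
  S-suc-0 n k = begin
    S (suc n) (suc k) ∣p^ 0
      ≈⟨ P.coeff-+ (S n k) (F (suc k) P.*ₚ S n (suc k)) 0 ⟩
    S n k ∣p^ 0 + (F (suc k) P.*ₚ S n (suc k)) ∣p^ 0
      ≈⟨ +-congˡ {S n k ∣p^ 0} (coeff-*-0 (F (suc k)) (S n (suc k))) ⟩
    S n k ∣p^ 0 + F (suc k) ∣p^ 0 * S n (suc k) ∣p^ 0
      ≈⟨ +-congˡ {S n k ∣p^ 0} (*-congʳ {S n (suc k) ∣p^ 0} (∣p^0-F k)) ⟩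
    S n k ∣p^ 0 + q ^ suc k * S n (suc k) ∣p^ 0 ∎

  -- The product rule at p^1 gives two terms; the one with the p-coefficient of F feeds the p^0
  -- triangle into the p^1 triangle.
  S-suc-1 : ∀ n k → S (suc n) (suc k) ∣p^ 1 ≈
    S n k ∣p^ 1 + (q ^ suc k * S n (suc k) ∣p^ 1 + (k ∸ 1) × (q ^ (k ∸ 1)) * S n (suc k) ∣p^ 0)
  S-suc-1 n k = begin
    S (suc n) (suc k) ∣p^ 1
      ≈⟨ P.coeff-+ (S n k) (F (suc k) P.*ₚ S n (suc k)) 1 ⟩
    S n k ∣p^ 1 + (F (suc k) P.*ₚ S n (suc k)) ∣p^ 1
      ≈⟨ +-congˡ {S n k ∣p^ 1} (coeff-*-1 (F (suc k)) (S n (suc k))) ⟩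
    S n k ∣p^ 1 + (F (suc k) ∣p^ 0 * S n (suc k) ∣p^ 1 + F (suc k) ∣p^ 1 * S n (suc k) ∣p^ 0)
      ≈⟨ +-congˡ {S n k ∣p^ 1} (+-cong (*-congʳ {S n (suc k) ∣p^ 1} (∣p^0-F k))
                                    (*-congʳ {S n (suc k) ∣p^ 0} (∣p^1-F k))) ⟩
    S n k ∣p^ 1 + (q ^ suc k * S n (suc k) ∣p^ 1 + (k ∸ 1) × (q ^ (k ∸ 1)) * S n (suc k) ∣p^ 0) ∎

  open Triangles Poly[q].polynomialRing q
  open FirstCoefficients (λ n k → S n k ∣p^ 0) (λ n k → S n k ∣p^ 1)
    refl (λ _ → refl) (λ n → P.coeff-≈ (S-above n) 0) S-suc-0
    S-0-1 (λ _ → refl) (λ n → P.coeff-≈ (S-above n) 1) S-suc-1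

  -- The closed forms in terms of Gaussian binomials.

  module _ (qbinom : ℕ → ℕ → Carrier) (isGaussian : IsGaussianBinomial qbinom) where
    private
      lower : ∀ m i → qbinom (m ℕ.+ i) m ≈ h m i
      lower = GaussianBinomials.qbinom-lower ℤ.+-*-commutativeRing qbinom isGaussian

      upper : ∀ m i → qbinom (m ℕ.+ i) i ≈ h m i
      upper = GaussianBinomials.qbinom-upper ℤ.+-*-commutativeRing qbinom isGaussian

    S-∣p^0 : ∀ k d → S (suc k ℕ.+ d) (suc k) ∣p^ 0 ≈ q ^ d * qbinom (k ℕ.+ d) k
    S-∣p^0 k d = trans (a-closed-form k d) (*-congˡ {q ^ d} (sym (lower k d)))

    -- With k = 2 + r and n = 2 + r + d, the binomial indices keep the shape of the theorem, so that
    -- afterwards 2 + r + d only has to be replaced by n.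
    S-∣p^1 : ∀ r d → S (2 ℕ.+ r ℕ.+ d) (2 ℕ.+ r) ∣p^ 1 ≈
      q ^ d * (∑[ j < r ] (let s = suc (toℕ j) in
        s × (q ^ (s ∸ 1)) * (∑[ i < d ] (
          q ^ (toℕ i ℕ.* (s ℕ.+ 1))
            * qbinom (toℕ i ℕ.+ (2 ℕ.+ r) ∸ s ∸ 2) (toℕ i)
            * qbinom (s ℕ.+ (2 ℕ.+ r ℕ.+ d) ∸ (2 ℕ.+ r) ∸ toℕ i) (s ℕ.+ 1)))))
    S-∣p^1 r d = trans (b-closed-form r d) (*-congˡ {q ^ d}
      (sum-cong-≋ {r} λ j → *-congˡ {suc (toℕ j) × (q ^ toℕ j)}
        (sum-cong-≋ {d} λ i → term (toℕ j) (toℕ i) (Fin.toℕ<n j) (Fin.toℕ<n i))))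
      where
      term : ∀ j i → j < r → i < d →
        q ^ (i ℕ.* (2 ℕ.+ j)) * h (r ∸ suc j) i * h (2 ℕ.+ j) (d ∸ suc i) ≈
        q ^ (i ℕ.* (suc j ℕ.+ 1)) * qbinom (i ℕ.+ (2 ℕ.+ r) ∸ suc j ∸ 2) i
          * qbinom (suc j ℕ.+ (2 ℕ.+ r ℕ.+ d) ∸ (2 ℕ.+ r) ∸ i) (suc j ℕ.+ 1)
      term j i j<r i<d = *-cong
        (*-cong (reflexive (≡.cong (λ e → q ^ (i ℕ.* e)) s+1))
          (sym (trans (reflexive (≡.cong (λ n → qbinom n i) top₁)) (upper (r ∸ suc j) i))))
        (sym (trans (reflexive (≡.cong₂ qbinom top₂ (≡.sym s+1))) (lower (2 ℕ.+ j) (d ∸ suc i))))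
        where
        s+1 : 2 ℕ.+ j ≡.≡ suc j ℕ.+ 1
        s+1 = ℕ.+-comm 1 (suc j)

        -- With s = j + 1 and k = r + 2, the bound j < r says s + 2 ≤ k, so no subtraction
        -- truncates.
        top₁ : i ℕ.+ (2 ℕ.+ r) ∸ suc j ∸ 2 ≡.≡ r ∸ suc j ℕ.+ i
        top₁ = ≡.trans (ℕ.∸-+-assoc (i ℕ.+ (2 ℕ.+ r)) (suc j) 2)
          (≡.trans (≡.cong (i ℕ.+ (2 ℕ.+ r) ∸_) (ℕ.+-comm (suc j) 2))
            (≡.trans (ℕ.+-∸-assoc i {2 ℕ.+ r} {3 ℕ.+ j} (s≤s (s≤s j<r)))
              (ℕ.+-comm i (r ∸ suc j))))

        -- The bound i < d lets one unit move out of d - i, which turns s = j + 1 into the j + 2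
        -- expected by `lower`.
        top₂ : suc j ℕ.+ (2 ℕ.+ r ℕ.+ d) ∸ (2 ℕ.+ r) ∸ i ≡.≡ 2 ℕ.+ j ℕ.+ (d ∸ suc i)
        top₂ = ≡.trans (≡.cong (_∸ i) (≡.trans
            (ℕ.+-∸-assoc (suc j) {2 ℕ.+ r ℕ.+ d} {2 ℕ.+ r} (ℕ.m≤m+n (2 ℕ.+ r) d))
            (≡.cong (suc j ℕ.+_) (ℕ.m+n∸m≡n (2 ℕ.+ r) d))))
          (≡.trans (ℕ.+-∸-assoc (suc j) {d} {i} (ℕ.<⇒≤ i<d))
            (≡.trans (≡.cong (suc j ℕ.+_) (ℕ.+-∸-assoc 1 i<d)) (ℕ.+-suc (suc j) (d ∸ suc i))))

-- The two coefficient formulas for an arbitrary solution `Sf`.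

theorem11 :
    let open ℤ[q] in
    (Sf : ℕ → ℕ → ℤ[q][p].Carrier) → IsSf Sf →
    (qbinom : ℕ → ℕ → ℤ[q].Carrier) → IsGaussianBinomial qbinom →
    (∀ n k → 1 ≤ k → k ≤ n →
      Sf n k ∣p^ 0 ≈ q ^ (n ∸ k) * qbinom (n ∸ 1) (k ∸ 1))
    ∧
    (∀ n k → 3 ≤ k → k < n →
      Sf n k ∣p^ 1 ≈
        q ^ (n ∸ k) * (∑[ j < k ∸ 2 ] (let s = suc (toℕ j) in
          s × (q ^ (s ∸ 1)) * (∑[ i < n ∸ k ] (
            q ^ (toℕ i ℕ.* (s ℕ.+ 1))
              * qbinom (toℕ i ℕ.+ k ∸ s ∸ 2) (toℕ i)
              * qbinom (s ℕ.+ n ∸ k ∸ toℕ i) (s ℕ.+ 1))))))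
theorem11 Sf isSf qbinom isGaussian = constant , linear
  where
  open ℤ[q]

  constant : ∀ n k → 1 ≤ k → k ≤ n →
    Sf n k ∣p^ 0 ≈ q ^ (n ∸ k) * qbinom (n ∸ 1) (k ∸ 1)
  constant n (suc k) _ k≤n =
    trans (Poly[p].coeff-≈ (S-unique Sf isSf k≤n) 0)
      (≡.subst
        (λ m → S m (suc k) ∣p^ 0 ≈ q ^ (n ∸ suc k) * qbinom (m ∸ 1) k)
        (ℕ.m+[n∸m]≡n k≤n) (S-∣p^0 qbinom isGaussian k (n ∸ suc k)))

  linear : ∀ n k → 3 ≤ k → k < n →
    Sf n k ∣p^ 1 ≈
      q ^ (n ∸ k) * (∑[ j < k ∸ 2 ] (let s = suc (toℕ j) in
        s × (q ^ (s ∸ 1)) * (∑[ i < n ∸ k ] (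
          q ^ (toℕ i ℕ.* (s ℕ.+ 1))
            * qbinom (toℕ i ℕ.+ k ∸ s ∸ 2) (toℕ i)
            * qbinom (s ℕ.+ n ∸ k ∸ toℕ i) (s ℕ.+ 1)))))
  linear n (suc (suc r)) (s≤s (s≤s _)) k<n =
    trans (Poly[p].coeff-≈ (S-unique Sf isSf (ℕ.<⇒≤ k<n)) 1)
      (≡.subst
        -- Here d is n - k; only the two places where n arises as k + d are abstracted.
        (λ m → S m (2 ℕ.+ r) ∣p^ 1 ≈
          q ^ (n ∸ (2 ℕ.+ r)) * (∑[ j < r ] (let s = suc (toℕ j) in
            s × (q ^ (s ∸ 1)) * (∑[ i < n ∸ (2 ℕ.+ r) ] (
              q ^ (toℕ i ℕ.* (s ℕ.+ 1))
                * qbinom (toℕ i ℕ.+ (2 ℕ.+ r) ∸ s ∸ 2) (toℕ i)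
                * qbinom (s ℕ.+ m ∸ (2 ℕ.+ r) ∸ toℕ i) (s ℕ.+ 1))))))
        (ℕ.m+[n∸m]≡n (ℕ.<⇒≤ k<n)) (S-∣p^1 qbinom isGaussian r (n ∸ (2 ℕ.+ r))))
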